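{- For all integers $n,k,s,b$ with $n \geq k \geq s > b \geq 0$, $n > 0$ and $n \geq k+s-b$, there exists an $(n,k,s,b)$-oriented graph.
   Context: An oriented graph is a digraph with no loops and no pair of symmetric arcs. For vertices $u,v$ write $u(1\text{ - }0)v$ if there is an arc from $u$ to $v$, and $u(0\text{ - }0)v$ if there is no arc between $u$ and $v$. A vertex $v$ is weakly reachable within two steps from $u$ if $u(1\text{ - }0)v$, or $u(0\text{ - }0)v$, or for some vertex $w$ one has $u(1\text{ - }0)w(1\text{ - }0)v$, or $u(1\text{ - }0)w(0\text{ - }0)v$, or $u(0\text{ - }0)w(1\text{ - }0)v$. A vertex $u$ is a weak king if every other vertex is weakly reachable within two steps from $u$, and a weak serf if $u$ is weakly reachable within two steps from every other vertex. An $(n,k,s,b)$-oriented graph is an oriented graph on $n$ vertices with exactly $k$ weak kings and exactly $s$ weak serfs, such that exactly $b$ of the weak kings are also weak serfs. -}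

module Defs where

open import Data.Fin using (Fin)
open import Data.Fin.Subset using (Subset; _∈_; _∩_; ∣_∣)
open import Data.Nat using (ℕ)
open import Data.Product using (_×_; ∃-syntax)
open import Data.Sum using (_⊎_)
open import Function.Bundles using (_⇔_)
open import Level using (0ℓ)
open import Relation.Binary.Core using (Rel)
open import Relation.Binary.Definitions using (Decidable)
open import Relation.Binary.PropositionalEquality using (_≡_; _≢_)
open import Relation.Nullary using (¬_)

record OrientedGraph (n : ℕ) : Set₁ where
  field
    Arc            : Rel (Fin n) 0ℓ
    arc?           : Decidable Arc
    noLoop         : ∀ u → ¬ Arc u u
    noSymmetricArc : ∀ u v → ¬ (Arc u v × Arc v u)

  -- u(0-0)v; it also holds for u = v. This does not affect reachability of
  -- another vertex: a path through w = u or w = v contains the arc u(1-0)v.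
  NoArcBetween : Rel (Fin n) 0ℓ
  NoArcBetween u v = ¬ Arc u v × ¬ Arc v u

  WeaklyReachable : Rel (Fin n) 0ℓ
  WeaklyReachable u v =
      Arc u v
    ⊎ NoArcBetween u v
    ⊎ (∃[ w ] ( (Arc u w × Arc w v)
              ⊎ (Arc u w × NoArcBetween w v)
              ⊎ (NoArcBetween u w × Arc w v)))

  WeakKing : Fin n → Set
  WeakKing u = ∀ v → v ≢ u → WeaklyReachable u v

  WeakSerf : Fin n → Set
  WeakSerf u = ∀ v → v ≢ u → WeaklyReachable v u

record IsNKSB {n : ℕ} (G : OrientedGraph n) (k s b : ℕ) : Set where
  open OrientedGraph G
  field
    kings   : Subset n
    serfs   : Subset n
    ∈kings  : ∀ u → u ∈ kings ⇔ WeakKing u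
    ∈serfs  : ∀ u → u ∈ serfs ⇔ WeakSerf u
    #kings  : ∣ kings ∣ ≡ k
    #serfs  : ∣ serfs ∣ ≡ s
    #both   : ∣ kings ∩ serfs ∣ ≡ b

{-# OPTIONS --safe #-}

-- Take k − b sources, s − b sinks and b isolated vertices, let the remaining
-- vertices be "middle", and draw all arcs source → middle, middle → sink and
-- source → sink. Sources and isolated vertices reach every vertex in one weak
-- step. A middle vertex or a sink never reaches a source: no arc enters a
-- source, and every vertex not adjacent to a source is itself a source or
-- isolated, so it has no arc entering it either. Reversing the arcs gives the
-- serfs. A source and a sink exist because k ≥ s > b.

module Submission where

open import Defs
open import Data.Bool using (Bool; true; false; T; T?; _∧_; if_then_else_)
open import Data.Fin using (Fin; zero; suc; _≟_)
open import Data.Fin.Subset using (_∈_; _∩_; ∣_∣)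
open import Data.Nat using (ℕ; zero; suc; _+_; _∸_; _≥_; _>_)
open import Data.Nat.Properties using (+-identityʳ; m+n∸m≡n; m≤n⇒∃[o]m+o≡n; ≤-trans)
open import Data.Nat.Tactic.RingSolver using (solve-∀)
open import Data.Product using (Σ-syntax; ∃-syntax; _×_; _,_)
open import Data.Sum using (_⊎_; inj₁; inj₂)
open import Data.Vec using (Vec; []; _∷_; _++_; lookup; map; replicate)
open import Data.Vec.Properties using (lookup-map; lookup⇒[]=; []=⇒lookup)
open import Function.Bundles using (_⇔_; mk⇔)
open import Relation.Binary.PropositionalEquality using (_≡_; refl; sym; trans; cong; subst; module ≡-Reasoning)
open import Relation.Nullary using (¬_; yes; no; contradiction)

data Kind : Set where
  source isolated middle sink : Kind

-- Boolean-valued so that `T` computes each arc statement to the unit or the empty type, which lets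
-- `_` and absurd patterns settle the cases.
arcKind : Kind → Kind → Bool
arcKind source middle = true
arcKind source sink   = true
arcKind middle sink   = true
arcKind _      _      = false

infix 4 _⟶_ _∥_

_⟶_ : Kind → Kind → Set
x ⟶ y = T (arcKind x y)

_∥_ : Kind → Kind → Set
x ∥ y = ¬ (x ⟶ y) × ¬ (y ⟶ x)

⟶-irrefl : ∀ x → ¬ (x ⟶ x)
⟶-irrefl source   ()
⟶-irrefl isolated ()
⟶-irrefl middle   ()
⟶-irrefl sink     ()

⟶-asym : ∀ x y → ¬ (x ⟶ y × y ⟶ x)
⟶-asym source middle (_ , ())
⟶-asym source sink   (_ , ())
⟶-asym middle sink   (_ , ())

source-minimal : ∀ x → ¬ (x ⟶ source)
source-minimal source   ()
source-minimal isolated ()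
source-minimal middle   ()
source-minimal sink     ()

-- Only `middle` and `sink` receive arcs, and `source` has an arc to both. In the omitted cases
-- `x ⟶ y` is empty.
∥source⇒minimal : ∀ x y → y ∥ source → ¬ (x ⟶ y)
∥source⇒minimal source middle (_ , ¬arc) _ = ¬arc _
∥source⇒minimal source sink   (_ , ¬arc) _ = ¬arc _
∥source⇒minimal middle sink   (_ , ¬arc) _ = ¬arc _

-- Dually, a kind with an outgoing arc is `source` or `middle`, and both have an arc to `sink`.
∥sink⇒maximal : ∀ x y → sink ∥ x → ¬ (x ⟶ y)
∥sink⇒maximal source middle (_ , ¬arc) _ = ¬arc _
∥sink⇒maximal source sink   (_ , ¬arc) _ = ¬arc _
∥sink⇒maximal middle sink   (_ , ¬arc) _ = ¬arc _

isKing : Kind → Bool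
isKing source   = true
isKing isolated = true
isKing middle   = false
isKing sink     = false

isSerf : Kind → Bool
isSerf source   = false
isSerf isolated = true
isSerf middle   = false
isSerf sink     = true

king-step : ∀ x y → isKing x ≡ true → x ⟶ y ⊎ x ∥ y
king-step source   source   _ = inj₂ ((λ ()) , λ ())
king-step source   isolated _ = inj₂ ((λ ()) , λ ())
king-step source   middle   _ = inj₁ _
king-step source   sink     _ = inj₁ _
king-step isolated source   _ = inj₂ ((λ ()) , λ ())
king-step isolated isolated _ = inj₂ ((λ ()) , λ ())
king-step isolated middle   _ = inj₂ ((λ ()) , λ ())
king-step isolated sink     _ = inj₂ ((λ ()) , λ ())

serf-step : ∀ x y → isSerf y ≡ true → x ⟶ y ⊎ x ∥ y
serf-step source   sink     _ = inj₁ _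
serf-step isolated sink     _ = inj₂ ((λ ()) , λ ())
serf-step middle   sink     _ = inj₁ _
serf-step sink     sink     _ = inj₂ ((λ ()) , λ ())
serf-step source   isolated _ = inj₂ ((λ ()) , λ ())
serf-step isolated isolated _ = inj₂ ((λ ()) , λ ())
serf-step middle   isolated _ = inj₂ ((λ ()) , λ ())
serf-step sink     isolated _ = inj₂ ((λ ()) , λ ())

∥source⇒isKing : ∀ x → x ∥ source → isKing x ≡ true
∥source⇒isKing source   _          = refl
∥source⇒isKing isolated _          = refl
∥source⇒isKing middle   (_ , ¬arc) = contradiction _ ¬arc
∥source⇒isKing sink     (_ , ¬arc) = contradiction _ ¬arc

∥sink⇒isSerf : ∀ x → sink ∥ x → isSerf x ≡ true
∥sink⇒isSerf source   (_ , ¬arc) = contradiction _ ¬arc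
∥sink⇒isSerf isolated _          = refl
∥sink⇒isSerf middle   (_ , ¬arc) = contradiction _ ¬arc
∥sink⇒isSerf sink     _          = refl

-- Weak reachability among the four kinds. The intermediate `z` may be a kind that no vertex has,
-- which is harmless because this relation serves only as a necessary condition for
-- `WeaklyReachable`.
KindReachable : Kind → Kind → Set
KindReachable x y =
  x ⟶ y ⊎ x ∥ y ⊎ ∃[ z ] (x ⟶ z × z ⟶ y ⊎ x ⟶ z × z ∥ y ⊎ x ∥ z × z ⟶ y)

reach-source⇒isKing : ∀ x → KindReachable x source → isKing x ≡ true
reach-source⇒isKing x (inj₁ x⟶s) = contradiction x⟶s (source-minimal x)
reach-source⇒isKing x (inj₂ (inj₁ x∥s)) = ∥source⇒isKing x x∥s
reach-source⇒isKing x (inj₂ (inj₂ (z , inj₁ (_ , z⟶s)))) =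
  contradiction z⟶s (source-minimal z)
reach-source⇒isKing x (inj₂ (inj₂ (z , inj₂ (inj₁ (x⟶z , z∥s))))) =
  contradiction x⟶z (∥source⇒minimal x z z∥s)
reach-source⇒isKing x (inj₂ (inj₂ (z , inj₂ (inj₂ (_ , z⟶s))))) =
  contradiction z⟶s (source-minimal z)

reach-from-sink⇒isSerf : ∀ y → KindReachable sink y → isSerf y ≡ true
-- Every route that starts with an arc out of `sink` has an empty type, so two cases remain.
reach-from-sink⇒isSerf y (inj₂ (inj₁ t∥y)) = ∥sink⇒isSerf y t∥y
reach-from-sink⇒isSerf y (inj₂ (inj₂ (z , inj₂ (inj₂ (t∥z , z⟶y))))) =
  contradiction z⟶y (∥sink⇒maximal z y t∥z)

module _ {n : ℕ} (kinds : Vec Kind n) where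

  private
    kind : Fin n → Kind
    kind = lookup kinds

  kindGraph : OrientedGraph n
  kindGraph = record
    { Arc            = λ u v → kind u ⟶ kind v
    ; arc?           = λ u v → T? (arcKind (kind u) (kind v))
    ; noLoop         = λ u → ⟶-irrefl (kind u)
    ; noSymmetricArc = λ u v → ⟶-asym (kind u) (kind v)
    }

  open OrientedGraph kindGraph

  step⇒reachable : ∀ {u v} → kind u ⟶ kind v ⊎ kind u ∥ kind v → WeaklyReachable u v
  step⇒reachable (inj₁ arc)   = inj₁ arc
  step⇒reachable (inj₂ noArc) = inj₂ (inj₁ noArc)

  -- Arcs and non-arcs depend on kinds alone, so replacing `w` by its kind keeps the proof.
  reachable⇒kindReachable : ∀ {u v} → WeaklyReachable u v → KindReachable (kind u) (kind v)
  reachable⇒kindReachable (inj₁ arc)                  = inj₁ arc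
  reachable⇒kindReachable (inj₂ (inj₁ noArc))         = inj₂ (inj₁ noArc)
  reachable⇒kindReachable (inj₂ (inj₂ (w , twoStep))) = inj₂ (inj₂ (kind w , twoStep))

  -- A `Subset` is a Boolean vector, so `map f kinds` is already the set of vertices whose kind
  -- satisfies `f`.
  ∈-map⇔ : ∀ (f : Kind → Bool) u {P : Set} → (f (kind u) ≡ true → P) → (P → f (kind u) ≡ true) → u ∈ map f kinds ⇔ P
  ∈-map⇔ f u to from = mk⇔
    (λ u∈ → to (trans (sym (lookup-map u f kinds)) ([]=⇒lookup u∈)))
    (λ p → lookup⇒[]= u (map f kinds) (trans (lookup-map u f kinds) (from p)))

  -- The source `i` is the vertex that a non-king fails to reach.
  isKing⇔WeakKing : ∀ i → kind i ≡ source → ∀ u → u ∈ map isKing kinds ⇔ WeakKing u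
  isKing⇔WeakKing i i-source u = ∈-map⇔ isKing u
    (λ king v _ → step⇒reachable (king-step (kind u) (kind v) king)) from
    where
    from : WeakKing u → isKing (kind u) ≡ true
    from reach with i ≟ u
    -- `WeakKing` says nothing about reaching `u` itself, but here `u` is a source.
    ... | yes refl = cong isKing i-source
    ... | no  i≢u  = reach-source⇒isKing (kind u)
      (subst (KindReachable (kind u)) i-source (reachable⇒kindReachable (reach i i≢u)))

  isSerf⇔WeakSerf : ∀ j → kind j ≡ sink → ∀ u → u ∈ map isSerf kinds ⇔ WeakSerf u
  isSerf⇔WeakSerf j j-sink u = ∈-map⇔ isSerf u
    (λ serf v _ → step⇒reachable (serf-step (kind v) (kind u) serf)) from
    where
    from : WeakSerf u → isSerf (kind u) ≡ true
    from reach with j ≟ u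
    ... | yes refl = cong isSerf j-sink
    ... | no  j≢u  = reach-from-sink⇒isSerf (kind u)
      (subst (λ x → KindReachable x (kind u)) j-sink (reachable⇒kindReachable (reach j j≢u)))

∣map-replicate-++∣ : ∀ {A : Set} {m} (f : A → Bool) x n (xs : Vec A m) →
  ∣ map f (replicate n x ++ xs) ∣ ≡ (if f x then n else 0) + ∣ map f xs ∣
∣map-replicate-++∣ f x zero    xs with f x
... | true  = refl
... | false = refl
∣map-replicate-++∣ f x (suc n) xs with f x | ∣map-replicate-++∣ f x n xs
... | true  | ih = cong suc ih
... | false | ih = ih

∩-map : ∀ {A : Set} {n} (f g : A → Bool) (xs : Vec A n) →
  map f xs ∩ map g xs ≡ map (λ x → f x ∧ g x) xs
∩-map f g []       = refl
∩-map f g (x ∷ xs) = cong (f x ∧ g x ∷_) (∩-map f g xs)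

m+[n+0]≡n+m : ∀ m n → m + (n + 0) ≡ n + m
m+[n+0]≡n+m = solve-∀

module _ (a c b r : ℕ) where

  private
    -- The trailing `++ []` gives the last block the form that `∣map-replicate-++∣` counts.
    middles : Vec Kind (r + 0)
    middles = replicate r middle ++ []

  tail : Vec Kind (a + (c + (b + (r + 0))))
  tail = replicate a source ++ replicate c sink ++ replicate b isolated ++ middles

  -- One source and one sink stand in front, so that positions 0 and 1 are known witnesses and the
  -- king and serf counts each begin with `suc`.
  layout : Vec Kind (2 + (a + (c + (b + (r + 0)))))
  layout = source ∷ sink ∷ tail

  ∣map-tail∣ : ∀ f → ∣ map f tail ∣ ≡
    (if f source then a else 0) + ((if f sink then c else 0) +
    ((if f isolated then b else 0) + ((if f middle then r else 0) + 0)))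
  ∣map-tail∣ f
    rewrite ∣map-replicate-++∣ f source a (replicate c sink ++ replicate b isolated ++ middles)
          | ∣map-replicate-++∣ f sink c (replicate b isolated ++ middles)
          | ∣map-replicate-++∣ f isolated b middles
          | ∣map-replicate-++∣ f middle r []
    = refl

  layout-NKSB : IsNKSB (kindGraph layout) (suc b + a) (suc b + c) b
  layout-NKSB = record
    { kings  = map isKing layout
    ; serfs  = map isSerf layout
    ; ∈kings = isKing⇔WeakKing layout zero refl
    ; ∈serfs = isSerf⇔WeakSerf layout (suc zero) refl
    ; #kings = cong suc (trans (∣map-tail∣ isKing) (m+[n+0]≡n+m a b))
    ; #serfs = cong suc (trans (∣map-tail∣ isSerf) (m+[n+0]≡n+m c b))
    ; #both  = trans (cong ∣_∣ (∩-map isKing isSerf layout))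
                     (trans (∣map-tail∣ (λ x → isKing x ∧ isSerf x)) (+-identityʳ b))
    }

-- Truncated subtraction disappears once `b` is displayed as a summand of k + s and cancelled.
order : ∀ a c b r → 2 + (a + (c + (b + (r + 0)))) ≡ (suc b + a) + (suc b + c) ∸ b + r
order a c b r = begin
  2 + (a + (c + (b + (r + 0))))      ≡⟨ reorder a c b r ⟩
  (suc a + (suc b + c)) + r          ≡⟨ cong (_+ r) (m+n∸m≡n b (suc a + (suc b + c))) ⟨
  b + (suc a + (suc b + c)) ∸ b + r  ≡⟨ cong (λ m → m ∸ b + r) (regroup a c b) ⟩
  (suc b + a) + (suc b + c) ∸ b + r  ∎
  where
  open ≡-Reasoning
  reorder : ∀ a c b r → 2 + (a + (c + (b + (r + 0)))) ≡ (suc a + (suc b + c)) + r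
  reorder = solve-∀
  regroup : ∀ a c b → b + (suc a + (suc b + c)) ≡ (suc b + a) + (suc b + c)
  regroup = solve-∀

theorem9 : ∀ (n k s b : ℕ) → n ≥ k → k ≥ s → s > b → b ≥ 0 → n > 0 → n ≥ k + s ∸ b → Σ[ G ∈ OrientedGraph n ] IsNKSB G k s b
theorem9 n k s b _ k≥s s>b _ _ n≥k+s∸b
  -- `a` and `c` count the sources and sinks beyond the first: k = b + 1 + a and s = b + 1 + c.
  with a , refl ← m≤n⇒∃[o]m+o≡n (≤-trans s>b k≥s)
     | c , refl ← m≤n⇒∃[o]m+o≡n s>b
  -- `r` is the number of middle vertices, the surplus of n over k + s - b.
  with r , refl ← m≤n⇒∃[o]m+o≡n n≥k+s∸b
  = subst (λ m → Σ[ G ∈ OrientedGraph m ] IsNKSB G (suc b + a) (suc b + c) b)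
      (order a c b r) (kindGraph (layout a c b r) , layout-NKSB a c b r)
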